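{- $\mathsf{RT}^1_3\le_\mathrm{sW}\mathsf{ADC}$.
   Context: Problems are multi-valued partial functions $\subseteq\omega^\omega\rightrightarrows\omega^\omega$ with standard codings. $\mathcal{F}\le_\mathrm{sW}\mathcal{G}$ if there are Turing functionals $\Phi,\Psi$ with $\Phi(f)\in\mathrm{dom}(\mathcal{G})$ for all $f\in\mathrm{dom}(\mathcal{F})$ and $\Psi(g)\in\mathcal{F}(f)$ for all $f\in\mathrm{dom}(\mathcal F)$, $g\in\mathcal{G}(\Phi(f))$. $\mathsf{RT}^1_3$: input $c\colon\omega\to\{0,1,2\}$; output an infinite $H\subseteq\omega$ on which $c$ is constant. $\mathsf{ADC}$: input an infinite linear order $(L,<_L)$ with $L\subseteq\omega$; output an infinite $S\subseteq L$ that is an ascending chain ($\{x\in S:x<_Ly\}$ finite for every $y\in S$) or a descending chain ($\{x\in S:y<_Lx\}$ finite for every $y\in S$). -}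

module Defs where

open import Data.Nat using (ℕ; zero; suc; _+_; _≤_; _<_)
open import Data.Fin using (Fin)
open import Data.Vec using (Vec; []; _∷_; lookup)
open import Data.Product using (Σ; ∃; _×_)
open import Data.Sum using (_⊎_)
open import Relation.Binary.PropositionalEquality using (_≡_; _≢_)

Baire : Set
Baire = ℕ → ℕ

-- Turing functionals: codes of partial recursive functions with an
-- oracle (Kleene's oracle μ-recursive functions).  A code is a finite
-- syntactic object, so only countably many functionals exist and they
-- are exactly the Turing functionals.

data Code : ℕ → Set where
  zer : ∀ {n} → Code n
  sucᶜ : Code 1
  prj : ∀ {n} → Fin n → Code n
  orc : Code 1
  cmp : ∀ {m n} → Code m → Vec (Code n) m → Code n
  rec : ∀ {n} → Code n → Code (suc (suc n)) → Code (suc n)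
  mnz : ∀ {n} → Code (suc n) → Code n

-- Big-step semantics relative to the oracle f (partial: a computation
-- converges iff a derivation exists).
mutual
  data Eval (f : Baire) : ∀ {n} → Code n → Vec ℕ n → ℕ → Set where
    ev-zer : ∀ {n} {xs : Vec ℕ n} → Eval f zer xs 0
    ev-suc : ∀ {x} → Eval f sucᶜ (x ∷ []) (suc x)
    ev-prj : ∀ {n} {i : Fin n} {xs : Vec ℕ n} → Eval f (prj i) xs (lookup xs i)
    ev-orc : ∀ {x} → Eval f orc (x ∷ []) (f x)
    ev-cmp : ∀ {m n} {h : Code m} {gs : Vec (Code n) m} {xs : Vec ℕ n}
               {ys : Vec ℕ m} {z : ℕ} →
             Evals f gs xs ys → Eval f h ys z → Eval f (cmp h gs) xs z
    ev-rec0 : ∀ {n} {g : Code n} {h : Code (suc (suc n))} {xs : Vec ℕ n} {z : ℕ} →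
              Eval f g xs z → Eval f (rec g h) (0 ∷ xs) z
    ev-recS : ∀ {n} {g : Code n} {h : Code (suc (suc n))} {xs : Vec ℕ n}
                {k z w : ℕ} →
              Eval f (rec g h) (k ∷ xs) z → Eval f h (k ∷ z ∷ xs) w →
              Eval f (rec g h) (suc k ∷ xs) w
    ev-mnz : ∀ {n} {g : Code (suc n)} {xs : Vec ℕ n} {y : ℕ} →
             Eval f g (y ∷ xs) 0 →
             (∀ z → z < y → ∃ λ v → Eval f g (z ∷ xs) (suc v)) →
             Eval f (mnz g) xs y

  data Evals (f : Baire) : ∀ {m n} → Vec (Code n) m → Vec ℕ n → Vec ℕ m → Set where
    evs-[] : ∀ {n} {xs : Vec ℕ n} → Evals f [] xs []
    evs-∷ : ∀ {m n} {g : Code n} {gs : Vec (Code n) m} {xs : Vec ℕ n}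
              {y : ℕ} {ys : Vec ℕ m} →
            Eval f g xs y → Evals f gs xs ys → Evals f (g ∷ gs) xs (y ∷ ys)

_⟦_⟧≡_ : Code 1 → Baire → Baire → Set
e ⟦ f ⟧≡ g = ∀ n → Eval f e (n ∷ []) (g n)

record Problem : Set₁ where
  field
    dom : Baire → Set
    sol : Baire → Baire → Set     -- sol f g : g ∈ P(f)

open Problem

_≤sW_ : Problem → Problem → Set
F ≤sW G = Σ (Code 1) λ Φ → Σ (Code 1) λ Ψ →
  ∀ f → dom F f →
    Σ Baire λ d → (Φ ⟦ f ⟧≡ d) × dom G d ×
      (∀ g → sol G d g → Σ Baire λ h → (Ψ ⟦ g ⟧≡ h) × sol F f h)

IsSetCode : Baire → Set
IsSetCode s = ∀ n → s n ≤ 1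

_∈ₛ_ : ℕ → Baire → Set
x ∈ₛ s = s x ≡ 1

InfiniteSet : Baire → Set
InfiniteSet s = ∀ n → ∃ λ m → n ≤ m × m ∈ₛ s

RT13 : Problem
RT13 = record
  { dom = λ c → ∀ n → c n < 3
  ; sol = λ c h → IsSetCode h × InfiniteSet h ×
                  ∃ λ i → ∀ m → m ∈ₛ h → c m ≡ i
  }

-- ADC.  Pairing ⟨x,y⟩ (Cantor) and linear orders coded by the
-- characteristic function of ≤_L on ω (x ∈ L iff x ≤_L x).

tri : ℕ → ℕ
tri zero = zero
tri (suc k) = suc k + tri k

pair : ℕ → ℕ → ℕ
pair x y = tri (x + y) + y

module LinOrd (d : Baire) where
  _≤L_ : ℕ → ℕ → Set
  x ≤L y = d (pair x y) ≡ 1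

  InL : ℕ → Set
  InL x = x ≤L x

  _<L_ : ℕ → ℕ → Set
  x <L y = x ≤L y × x ≢ y

  IsLinearOrder : Set
  IsLinearOrder =
    (∀ n → d n ≤ 1) ×
    (∀ x y → x ≤L y → InL x × InL y) ×
    (∀ x y → x ≤L y → y ≤L x → x ≡ y) ×
    (∀ x y z → x ≤L y → y ≤L z → x ≤L z) ×
    (∀ x y → InL x → InL y → x ≤L y ⊎ y ≤L x)

  InfiniteL : Set
  InfiniteL = ∀ n → ∃ λ m → n ≤ m × InL m

  FinBelow : Baire → ℕ → Set
  FinBelow s y = ∃ λ b → ∀ x → x ∈ₛ s → x <L y → x < b

  FinAbove : Baire → ℕ → Set
  FinAbove s y = ∃ λ b → ∀ x → x ∈ₛ s → y <L x → x < b

  Ascending : Baire → Set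
  Ascending s = ∀ y → y ∈ₛ s → FinBelow s y

  Descending : Baire → Set
  Descending s = ∀ y → y ∈ₛ s → FinAbove s y

ADC : Problem
ADC = record
  { dom = λ d → LinOrd.IsLinearOrder d × LinOrd.InfiniteL d
  ; sol = λ d s → IsSetCode s × InfiniteSet s ×
                  (∀ x → x ∈ₛ s → LinOrd.InL d x) ×
                  (LinOrd.Ascending d s ⊎ LinOrd.Descending d s)
  }

{-# OPTIONS --safe #-}
module Submission where

-- Scan a 3-colouring f with a counter, the phase, that goes up by one whenever the colour
-- read equals the phase modulo 3; the point read belongs to the new phase, so phase p
-- contains only the colours p + 1 and p + 2 modulo 3.  Each phase is placed around all the
-- earlier ones: its points of colour p + 1 form an ascending sequence below them, those of
-- colour p + 2 a descending sequence above them.  An infinite ascending chain either stays in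
-- the lower half of one phase, where all points have the same colour, or passes through
-- infinitely many phases, and then every colour recurs; descending chains are symmetric.
-- Either way the colour of any point of the chain recurs.  The n-th point is the number with
-- the base-3 digits 1, f 0, ..., f n, so a chain computes f, and with it the set of all
-- numbers with the colour of the chain's least element.

open import Defs
open import Data.Fin using (Fin)
open import Data.Fin.Patterns using (0F; 1F; 2F)
open import Data.Nat
  using (ℕ; zero; suc; pred; _+_; _*_; _∸_; _^_; _/_; _%_; _⊔_; _≤_; _<_; _≥_; _≤′_; ≤′-refl;
         ≤′-step; z≤n; s≤s; s≤s⁻¹; s<s⁻¹; NonZero; NonTrivial; nonTrivial⇒nonZero;
         nonTrivial⇒n>1; nonTrivial⇒≢1)
open import Data.Nat.Divisibility using (_∣_; n∣m*n; ∣1⇒≡1; ∣m+n∣m⇒∣n)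
open import Data.Nat.DivMod
  using (m≡m%n+[m/n]*n; m%n≡m∸m/n*n; m%n<n; m%n%n≡m%n; [m+kn]%n≡m%n; m<n⇒m%n≡m; %-distribˡ-+;
         m/n*n≤m; m<n⇒m/n≡0; m*n/n≡m; +-distrib-/-∣ʳ)
open import Data.Nat.GeneralisedArithmetic using (fold)
open import Data.Nat.Properties
open import Data.Product using (∃; _×_; _,_; proj₁)
open import Data.Product.Relation.Binary.Lex.NonStrict using (×-Lex; ×-isTotalOrder)
open import Data.Product.Relation.Binary.Pointwise.NonDependent
  using () renaming (Pointwise to ×-Pointwise)
open import Data.Sum using (_⊎_; inj₁; inj₂; [_,_]′)
import Data.Sum as Sum
open import Data.Sum.Relation.Binary.LeftOrder using (_⊎-<_; ₁∼₂; ₁∼₁; ₂∼₂; ⊎-<-isTotalOrder)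
open import Data.Sum.Relation.Binary.Pointwise
  using (inj₁; inj₂) renaming (Pointwise to ⊎-Pointwise)
open import Data.Vec using (Vec; []; _∷_; lookup; head; tail)
open import Function using (_∘_; id; flip; _⇔_; mk⇔; Equivalence)
open import Level using (0ℓ)
open import Relation.Binary using (Rel; Total; IsTotalOrder; _Preserves_⟶_)
import Relation.Binary.Construct.Flip.EqAndOrd as Flip
import Relation.Binary.Construct.On as On
open import Relation.Binary.PropositionalEquality
  using (_≡_; _≢_; refl; sym; trans; cong; cong₂; subst; subst₂; isEquivalence;
         module ≡-Reasoning)
open import Relation.Nullary using (¬_; Dec; yes; no; contradiction; ¬?; _×-dec_; _⊎-dec_)
import Relation.Nullary.Decidable as Dec

private
  variable
    n : ℕ
    A B C : Set

-- Indicators of decidable propositions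

𝟙 : Dec A → ℕ
𝟙 (yes _) = 1
𝟙 (no _)  = 0

𝟙≤1 : (A? : Dec A) → 𝟙 A? ≤ 1
𝟙≤1 (yes _) = ≤-refl
𝟙≤1 (no _)  = z≤n

𝟙≡1⇒ : (A? : Dec A) → 𝟙 A? ≡ 1 → A
𝟙≡1⇒ (yes a) _ = a

⇒𝟙≡1 : (A? : Dec A) → A → 𝟙 A? ≡ 1
⇒𝟙≡1 (yes _) _ = refl
⇒𝟙≡1 (no ¬a) a = contradiction a ¬a

⇒𝟙≡0 : (A? : Dec A) → ¬ A → 𝟙 A? ≡ 0
⇒𝟙≡0 (yes a) ¬a = contradiction a ¬a
⇒𝟙≡0 (no _)  _  = refl

𝟙-cong : A ⇔ B → (A? : Dec A) (B? : Dec B) → 𝟙 A? ≡ 𝟙 B?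
𝟙-cong A⇔B (yes a) B? = sym (⇒𝟙≡1 B? (Equivalence.to A⇔B a))
𝟙-cong A⇔B (no ¬a) B? = sym (⇒𝟙≡0 B? (¬a ∘ Equivalence.from A⇔B))

𝟙-¬ : (A? : Dec A) → 1 ∸ 𝟙 A? ≡ 𝟙 (¬? A?)
𝟙-¬ (yes _) = refl
𝟙-¬ (no _)  = refl

𝟙-× : (A? : Dec A) (B? : Dec B) → 𝟙 A? * 𝟙 B? ≡ 𝟙 (A? ×-dec B?)
𝟙-× (yes _) (yes _) = refl
𝟙-× (yes _) (no _)  = refl
𝟙-× (no _)  _       = refl

𝟙-⊎ : (A? : Dec A) (B? : Dec B) → 1 ∸ (1 ∸ 𝟙 A?) * (1 ∸ 𝟙 B?) ≡ 𝟙 (A? ⊎-dec B?)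
𝟙-⊎ (yes _) _       = refl
𝟙-⊎ (no _)  (yes _) = refl
𝟙-⊎ (no _)  (no _)  = refl

𝟙-≤ : ∀ a b → 1 ∸ (a ∸ b) ≡ 𝟙 (a ≤? b)
𝟙-≤ a b with a ≤? b
... | yes a≤b = cong (1 ∸_) (m≤n⇒m∸n≡0 a≤b)
... | no  a≰b = m≤n⇒m∸n≡0 (m<n⇒0<n∸m (≰⇒> a≰b))

-- Computable functions and decidable relations

Fun : ℕ → Set
Fun n = Baire → Vec ℕ n → ℕ

record Computable (F : Fun n) : Set where
  constructor computable
  field
    code    : Code n
    correct : ∀ f xs → Eval f code xs (F f xs)

open Computable

private
  variable
    F G : Fun n

Computable-resp : (∀ f xs → F f xs ≡ G f xs) → Computable F → Computable G
Computable-resp F≗G g = computable (code g) λ f xs → subst (Eval f _ xs) (F≗G f xs) (correct g f xs)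

var : ∀ (i : Fin n) → Computable (λ _ xs → lookup xs i)
var i = computable (prj i) λ _ _ → ev-prj

compose₁ : {H : Fun 1} → Computable H → Computable F → Computable (λ f xs → H f (F f xs ∷ []))
compose₁ h g = computable (cmp (code h) (code g ∷ []))
  λ f xs → ev-cmp (evs-∷ (correct g f xs) evs-[]) (correct h f _)

compose₂ : {H : Fun 2} → Computable H → Computable F → Computable G →
           Computable (λ f xs → H f (F f xs ∷ G f xs ∷ []))
compose₂ h g k = computable (cmp (code h) (code g ∷ code k ∷ []))
  λ f xs → ev-cmp (evs-∷ (correct g f xs) (evs-∷ (correct k f xs) evs-[])) (correct h f _)

1+ᶜ_ : Computable F → Computable (λ f xs → suc (F f xs))
1+ᶜ_ = compose₁ {H = λ _ xs → suc (head xs)} (computable sucᶜ λ { _ (_ ∷ []) → ev-suc })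

oracleᶜ : Computable F → Computable (λ f xs → f (F f xs))
oracleᶜ = compose₁ {H = λ f xs → f (head xs)} (computable orc λ { _ (_ ∷ []) → ev-orc })

constᶜ : ∀ k → Computable {n} (λ _ _ → k)
constᶜ zero    = computable zer λ _ _ → ev-zer
constᶜ (suc k) = 1+ᶜ constᶜ k

primrec : ∀ {H : Fun (suc (suc n))} (T : Baire → ℕ → Vec ℕ n → ℕ) → Computable G → Computable H →
          (∀ f xs → T f 0 xs ≡ G f xs) →
          (∀ f k xs → T f (suc k) xs ≡ H f (k ∷ T f k xs ∷ xs)) →
          Computable (λ f xs → T f (head xs) (tail xs))
primrec T g h base step = computable (rec (code g) (code h)) λ { f (k ∷ xs) → eval f k xs }
  where
  eval : ∀ f k xs → Eval f (rec (code g) (code h)) (k ∷ xs) (T f k xs)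
  eval f zero    xs = subst (Eval f _ _) (sym (base f xs)) (ev-rec0 (correct g f xs))
  eval f (suc k) xs = subst (Eval f _ _) (sym (step f k xs)) (ev-recS (eval f k xs) (correct h f _))

primrec₁ : {G : Fun 0} {H : Fun 2} (T : Baire → ℕ → ℕ) → Computable G → Computable H →
           (∀ f → T f 0 ≡ G f []) → (∀ f k → T f (suc k) ≡ H f (k ∷ T f k ∷ [])) →
           Computable F → Computable (λ f xs → T f (F f xs))
primrec₁ T g h base step =
  compose₁ (primrec (λ f k _ → T f k) g h (λ { f [] → base f }) (λ { f k [] → step f k }))

primrec₂ : {G : Fun 1} {H : Fun 3} (T : Baire → ℕ → ℕ → ℕ) → Computable G → Computable H →
           (∀ f x → T f 0 x ≡ G f (x ∷ [])) →
           (∀ f k x → T f (suc k) x ≡ H f (k ∷ T f k x ∷ x ∷ [])) →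
           ∀ {F F′ : Fun n} → Computable F → Computable F′ →
           Computable (λ f xs → T f (F f xs) (F′ f xs))
primrec₂ T g h base step =
  compose₂ (primrec (λ f k xs → T f k (head xs)) g h
             (λ { f (x ∷ []) → base f x }) (λ { f k (x ∷ []) → step f k x }))

infixl 6 _+ᶜ_ _∸ᶜ_
infixl 7 _*ᶜ_
infix  8 1+ᶜ_
infixr 9 _^ᶜ_

_+ᶜ_ : Computable F → Computable G → Computable (λ f xs → F f xs + G f xs)
_+ᶜ_ = primrec₂ (λ _ → _+_) (var 0F) (1+ᶜ var 1F) (λ _ _ → refl) (λ _ _ _ → refl)

_*ᶜ_ : Computable F → Computable G → Computable (λ f xs → F f xs * G f xs)
_*ᶜ_ = primrec₂ (λ _ → _*_) (constᶜ 0) (var 2F +ᶜ var 1F) (λ _ _ → refl) (λ _ _ _ → refl)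

predᶜ : Computable F → Computable (λ f xs → pred (F f xs))
predᶜ = primrec₁ (λ _ → pred) (constᶜ 0) (var 0F) (λ _ → refl) (λ _ _ → refl)

_∸ᶜ_ : Computable F → Computable G → Computable (λ f xs → F f xs ∸ G f xs)
g ∸ᶜ h = primrec₂ (λ _ k x → x ∸ k) (var 0F) (predᶜ (var 1F))
           (λ _ _ → refl) (λ _ k x → sym (pred[m∸n]≡m∸[1+n] x k)) h g

_^ᶜ_ : ∀ b → Computable F → Computable (λ f xs → b ^ F f xs)
b ^ᶜ g = primrec₁ (λ _ → b ^_) (constᶜ 1) (constᶜ b *ᶜ var 1F) (λ _ → refl) (λ _ _ → refl) g

record Decidable (P : Baire → Vec ℕ n → Set) : Set where
  constructor decidable
  field
    decide    : ∀ f xs → Dec (P f xs)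
    indicator : Computable (λ f xs → 𝟙 (decide f xs))

open Decidable

private
  variable
    P Q : Baire → Vec ℕ n → Set

Decidable-resp : (∀ f xs → P f xs ⇔ Q f xs) → Decidable P → Decidable Q
Decidable-resp P⇔Q p = decidable (λ f xs → Dec.map (P⇔Q f xs) (decide p f xs))
  (Computable-resp (λ f xs → 𝟙-cong (P⇔Q f xs) (decide p f xs) _) (indicator p))

infix  4 _≤ᵈ_ _≡ᵈ_
infix  3 ¬ᵈ_
infixr 2 _×ᵈ_
infixr 1 _⊎ᵈ_

¬ᵈ_ : Decidable P → Decidable (λ f xs → ¬ P f xs)
¬ᵈ p = decidable (λ f xs → ¬? (decide p f xs))
  (Computable-resp (λ f xs → 𝟙-¬ (decide p f xs)) (constᶜ 1 ∸ᶜ indicator p))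

_×ᵈ_ : Decidable P → Decidable Q → Decidable (λ f xs → P f xs × Q f xs)
p ×ᵈ q = decidable (λ f xs → decide p f xs ×-dec decide q f xs)
  (Computable-resp (λ f xs → 𝟙-× (decide p f xs) (decide q f xs)) (indicator p *ᶜ indicator q))

_⊎ᵈ_ : Decidable P → Decidable Q → Decidable (λ f xs → P f xs ⊎ Q f xs)
p ⊎ᵈ q = decidable (λ f xs → decide p f xs ⊎-dec decide q f xs)
  (Computable-resp (λ f xs → 𝟙-⊎ (decide p f xs) (decide q f xs))
    (constᶜ 1 ∸ᶜ (constᶜ 1 ∸ᶜ indicator p) *ᶜ (constᶜ 1 ∸ᶜ indicator q)))

_≤ᵈ_ : Computable F → Computable G → Decidable (λ f xs → F f xs ≤ G f xs)
_≤ᵈ_ {F = F} {G = G} g h = decidable (λ f xs → F f xs ≤? G f xs)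
  (Computable-resp (λ f xs → 𝟙-≤ (F f xs) (G f xs)) (constᶜ 1 ∸ᶜ (g ∸ᶜ h)))

_≡ᵈ_ : Computable F → Computable G → Decidable (λ f xs → F f xs ≡ G f xs)
_≡ᵈ_ {F = F} {G = G} g h = decidable (λ f xs → F f xs ≟ G f xs)
  (Computable-resp (λ f xs → 𝟙-cong ≤×≥⇔≡ (decide ≤×≥ f xs) (F f xs ≟ G f xs)) (indicator ≤×≥))
  where
  ≤×≥ : Decidable (λ f xs → F f xs ≤ G f xs × G f xs ≤ F f xs)
  ≤×≥ = g ≤ᵈ h ×ᵈ h ≤ᵈ g

  ≤×≥⇔≡ : ∀ {a b} → (a ≤ b × b ≤ a) ⇔ a ≡ b
  ≤×≥⇔≡ = mk⇔ (λ (a≤b , b≤a) → ≤-antisym a≤b b≤a) λ a≡b → ≤-reflexive a≡b , ≤-reflexive (sym a≡b)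

least : ∀ {P : ℕ → Set} (P? : ∀ x → Dec (P x)) y → P y → ∃ λ x → P x × (∀ z → z < x → ¬ P z)
least P? y Py with P? 0
... | yes P0 = 0 , P0 , λ _ ()
least P? zero    Py | no ¬P0 = contradiction Py ¬P0
least P? (suc y) Py | no ¬P0 with least (P? ∘ suc) y Py
... | x , Px , below = suc x , Px , λ { zero _ → ¬P0 ; (suc z) z<x → below z (s<s⁻¹ z<x) }

search : Decidable {suc n} P → Code n
search p = mnz (code (indicator (¬ᵈ p)))

search-finds : ∀ (p : Decidable {suc n} P) f xs → (∃ λ y → P f (y ∷ xs)) →
               ∃ λ x → P f (x ∷ xs) × Eval f (search p) xs x
search-finds {P = P} p f xs (y , Py) with least (λ x → decide p f (x ∷ xs)) y Py
... | x , Px , below = x , Px ,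
  ev-mnz (value (⇒𝟙≡0 (refute x) λ ¬Px → ¬Px Px)) λ z z<x → 0 , value (⇒𝟙≡1 (refute z) (below z z<x))
  where
  refute : ∀ z → Dec (¬ P f (z ∷ xs))
  refute z = decide (¬ᵈ p) f (z ∷ xs)

  value : ∀ {z v} → 𝟙 (refute z) ≡ v → Eval f (code (indicator (¬ᵈ p))) (z ∷ xs) v
  value refl = correct (indicator (¬ᵈ p)) f _

-- Inverses of strictly increasing functions

module _ {v : ℕ → ℕ} where

  step⇒mono-≤ : (∀ n → v n ≤ v (suc n)) → v Preserves _≤_ ⟶ _≤_
  step⇒mono-≤ step m≤n = climb (≤⇒≤′ m≤n)
    where
    climb : ∀ {m n} → m ≤′ n → v m ≤ v n
    climb ≤′-refl       = ≤-refl
    climb (≤′-step m≤n) = ≤-trans (climb m≤n) (step _)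

  mono-≤⇒cancel-< : v Preserves _≤_ ⟶ _≤_ → ∀ {m n} → v m < v n → m < n
  mono-≤⇒cancel-< mono vm<vn = ≰⇒> λ n≤m → <⇒≱ vm<vn (mono n≤m)

inverse : (ℕ → ℕ) → ℕ → ℕ
inverse v zero    = 0
inverse v (suc p) = 𝟙 (v (suc (inverse v p)) ≤? suc p) + inverse v p

module StrictlyIncreasing (v : ℕ → ℕ) (v-step : ∀ n → v n < v (suc n)) where

  cancel-< : ∀ {m n} → v m < v n → m < n
  cancel-< = mono-≤⇒cancel-< (step⇒mono-≤ (<⇒≤ ∘ v-step))

  n≤vn : ∀ n → n ≤ v n
  n≤vn zero    = z≤n
  n≤vn (suc n) = ≤-<-trans (n≤vn n) (v-step n)

  inverse-lower : ∀ p → inverse v p ≡ 0 ⊎ v (inverse v p) ≤ p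
  inverse-lower zero = inj₁ refl
  inverse-lower (suc p) with v (suc (inverse v p)) ≤? suc p | inverse-lower p
  ... | yes reached | _        = inj₂ reached
  ... | no _        | inj₁ ≡0  = inj₁ ≡0
  ... | no _        | inj₂ v≤p = inj₂ (m≤n⇒m≤1+n v≤p)

  inverse-upper : ∀ p → p < v (suc (inverse v p))
  inverse-upper zero = n≤vn 1
  inverse-upper (suc p) with v (suc (inverse v p)) ≤? suc p
  ... | yes _         = ≤-<-trans (inverse-upper p) (v-step _)
  ... | no  unreached = ≰⇒> unreached

  inverse-unique : ∀ {p s} → v s ≤ p → p < v (suc s) → inverse v p ≡ s
  inverse-unique {p} {s} vs≤p p<v1+s =
    ≤-antisym inverse≤s (s≤s⁻¹ (cancel-< (≤-<-trans vs≤p (inverse-upper p))))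
    where
    inverse≤s : inverse v p ≤ s
    inverse≤s with inverse-lower p
    ... | inj₁ ≡0  = subst (_≤ s) (sym ≡0) z≤n
    ... | inj₂ v≤p = s≤s⁻¹ (cancel-< (≤-<-trans v≤p p<v1+s))

inverseᶜ : ∀ {v} → Computable {1} (λ _ xs → v (lookup xs 0F)) →
           Computable F → Computable (λ f xs → inverse v (F f xs))
inverseᶜ {v = v} vᶜ = primrec₁ (λ _ → inverse v) (constᶜ 0)
  (indicator (compose₁ vᶜ (1+ᶜ var 1F) ≤ᵈ 1+ᶜ var 0F) +ᶜ var 1F) (λ _ → refl) (λ _ _ → refl)

-- Cantor unpairing

triᶜ : Computable F → Computable (λ f xs → tri (F f xs))
triᶜ = primrec₁ (λ _ → tri) (constᶜ 0) (1+ᶜ var 0F +ᶜ var 1F) (λ _ → refl) (λ _ _ → refl)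

diagonal unpair₁ unpair₂ : ℕ → ℕ
diagonal  = inverse tri
unpair₂ p = p ∸ tri (diagonal p)
unpair₁ p = diagonal p ∸ unpair₂ p

diagonal-pair : ∀ x y → diagonal (pair x y) ≡ x + y
diagonal-pair x y = inverse-unique (m≤m+n _ y) (begin-strict
  tri (x + y) + y        ≤⟨ +-monoʳ-≤ (tri (x + y)) (m≤n+m y x) ⟩
  tri (x + y) + (x + y)  ≡⟨ +-comm (tri (x + y)) (x + y) ⟩
  x + y + tri (x + y)    <⟨ n<1+n _ ⟩
  tri (suc (x + y))      ∎)
  where
  open ≤-Reasoning
  open StrictlyIncreasing tri (λ k → s≤s (m≤n+m (tri k) k))

unpair₂-pair : ∀ x y → unpair₂ (pair x y) ≡ y
unpair₂-pair x y rewrite diagonal-pair x y = m+n∸m≡n (tri (x + y)) y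

unpair₁-pair : ∀ x y → unpair₁ (pair x y) ≡ x
unpair₁-pair x y rewrite unpair₂-pair x y | diagonal-pair x y = m+n∸n≡m x y

diagonalᶜ : Computable F → Computable (λ f xs → diagonal (F f xs))
diagonalᶜ = inverseᶜ (triᶜ (var 0F))

unpair₂ᶜ : Computable F → Computable (λ f xs → unpair₂ (F f xs))
unpair₂ᶜ g = g ∸ᶜ triᶜ (diagonalᶜ g)

unpair₁ᶜ : Computable F → Computable (λ f xs → unpair₁ (F f xs))
unpair₁ᶜ g = diagonalᶜ g ∸ᶜ unpair₂ᶜ g

-- Division

module _ (b : ℕ) .{{_ : NonZero b}} where

  inverse-*≡/ : ∀ p → inverse (_* b) p ≡ p / b
  inverse-*≡/ p = inverse-unique (m/n*n≤m p b) (begin-strict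
    p                  ≡⟨ m≡m%n+[m/n]*n p b ⟩
    p % b + p / b * b  <⟨ +-monoˡ-< (p / b * b) (m%n<n p b) ⟩
    suc (p / b) * b    ∎)
    where
    open ≤-Reasoning
    open StrictlyIncreasing (_* b) (λ n → *-monoˡ-< b (n<1+n n))

  append-/ : ∀ q {r} → r < b → (r + q * b) / b ≡ q
  append-/ q {r} r<b = begin
    (r + q * b) / b    ≡⟨ +-distrib-/-∣ʳ r (n∣m*n q) ⟩
    r / b + q * b / b  ≡⟨ cong₂ _+_ (m<n⇒m/n≡0 r<b) (m*n/n≡m q b) ⟩
    q                  ∎
    where open ≡-Reasoning

  append-% : ∀ q {r} → r < b → (r + q * b) % b ≡ r
  append-% q {r} r<b = trans ([m+kn]%n≡m%n r q b) (m<n⇒m%n≡m r<b)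

  append-< : ∀ {q p r} → r < b → q < p → r + q * b < b * p
  append-< {q} {p} {r} r<b q<p = begin-strict
    r + q * b  <⟨ +-monoˡ-< (q * b) r<b ⟩
    suc q * b  ≤⟨ *-monoˡ-≤ b q<p ⟩
    p * b      ≡⟨ *-comm p b ⟩
    b * p      ∎
    where open ≤-Reasoning

  residue-reached : ∀ p {i} → i < b → ∃ λ j → j < b × (j + p) % b ≡ i
  residue-reached p {i} i<b = a % b , m%n<n a b , (begin
    (a % b + p) % b            ≡⟨ %-distribˡ-+ (a % b) p b ⟩
    (a % b % b + p % b) % b    ≡⟨ cong (λ t → (t + p % b) % b) (m%n%n≡m%n a b) ⟩
    (a % b + p % b) % b        ≡⟨ %-distribˡ-+ a p b ⟨
    (a + p) % b                ≡⟨ cong (_% b) (+-assoc i (p * b ∸ p) p) ⟩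
    (i + (p * b ∸ p + p)) % b  ≡⟨ cong (λ t → (i + t) % b) (m∸n+n≡m (m≤m*n p b)) ⟩
    (i + p * b) % b            ≡⟨ append-% p i<b ⟩
    i                          ∎)
    where
    open ≡-Reasoning
    a : ℕ
    a = i + (p * b ∸ p)

  m%b≢[1+m]%b : .{{_ : NonTrivial b}} → ∀ m → m % b ≢ suc m % b
  m%b≢[1+m]%b m same =
    nonTrivial⇒≢1 (∣1⇒≡1 (∣m+n∣m⇒∣n (subst (b ∣_) multiples (n∣m*n (suc m / b))) (n∣m*n (m / b))))
    where
    open ≡-Reasoning
    multiples : suc m / b * b ≡ m / b * b + 1
    multiples = +-cancelˡ-≡ (m % b) _ _ (begin
      m % b + suc m / b * b      ≡⟨ cong (_+ suc m / b * b) same ⟩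
      suc m % b + suc m / b * b  ≡⟨ m≡m%n+[m/n]*n (suc m) b ⟨
      suc m                      ≡⟨ +-comm 1 m ⟩
      m + 1                      ≡⟨ cong (_+ 1) (m≡m%n+[m/n]*n m b) ⟩
      m % b + m / b * b + 1      ≡⟨ +-assoc (m % b) (m / b * b) 1 ⟩
      m % b + (m / b * b + 1)    ∎)

infixl 7 _/ᶜ_ _%ᶜ_

_/ᶜ_ : Computable F → ∀ b .{{_ : NonZero b}} → Computable (λ f xs → F f xs / b)
_/ᶜ_ {F = F} g b = Computable-resp (λ f xs → inverse-*≡/ b (F f xs)) (inverseᶜ (var 0F *ᶜ constᶜ b) g)

_%ᶜ_ : Computable F → ∀ b .{{_ : NonZero b}} → Computable (λ f xs → F f xs % b)
_%ᶜ_ {F = F} g b = Computable-resp (λ f xs → sym (m%n≡m∸m/n*n (F f xs) b)) (g ∸ᶜ g /ᶜ b *ᶜ constᶜ b)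

-- Initial segments as numerals

Colouring : ℕ → Baire → Set
Colouring k f = ∀ n → f n < k

scan : (ℕ → ℕ → ℕ) → ℕ → Baire → ℕ → ℕ
scan step z f zero    = step z (f 0)
scan step z f (suc n) = step (scan step z f n) (f (suc n))

scanᶜ : ∀ {step} → Computable {2} (λ _ xs → step (lookup xs 0F) (lookup xs 1F)) → ∀ z →
        Computable F → Computable (λ f xs → scan step z f (F f xs))
scanᶜ {step = step} stepᶜ z = primrec₁ (scan step z)
  (compose₂ stepᶜ (constᶜ z) (oracleᶜ (constᶜ 0)))
  (compose₂ stepᶜ (var 1F) (oracleᶜ (1+ᶜ var 0F)))
  (λ _ → refl) (λ _ _ → refl)

module Numeral (b : ℕ) .{{_ : NonTrivial b}} where

  private instance
    b≢0 : NonZero b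
    b≢0 = nonTrivial⇒nonZero b

  append : ℕ → ℕ → ℕ
  append x c = c + x * b

  -- The leading digit 1 makes the length readable when f starts with zeros.
  numeral : Baire → ℕ → ℕ
  numeral = scan append 1

  stage : ℕ → ℕ
  stage = inverse (λ n → b ^ suc n)

  -- Digits are counted downwards from the one after the leading 1.
  digit : ℕ → ℕ → ℕ
  digit m x = fold x (_/ b) (stage x ∸ m) % b

  numeralᶜ : Computable F → Computable (λ f xs → numeral f (F f xs))
  numeralᶜ = scanᶜ (var 1F +ᶜ var 0F *ᶜ constᶜ b) 1

  stageᶜ : Computable F → Computable (λ f xs → stage (F f xs))
  stageᶜ = inverseᶜ (b ^ᶜ (1+ᶜ var 0F))

  digitᶜ : Computable F → Computable G → Computable (λ f xs → digit (F f xs) (G f xs))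
  digitᶜ g h = truncateᶜ (stageᶜ h ∸ᶜ g) h %ᶜ b
    where
    truncateᶜ : Computable F → Computable G → Computable (λ f xs → fold (G f xs) (_/ b) (F f xs))
    truncateᶜ = primrec₂ (λ _ k x → fold x (_/ b) k) (var 0F) (var 1F /ᶜ b)
                  (λ _ _ → refl) (λ _ _ _ → refl)

  module _ {f : Baire} (f<b : Colouring b f) where

    numeral-% : ∀ n → numeral f n % b ≡ f n
    numeral-% zero    = append-% b 1 (f<b 0)
    numeral-% (suc n) = append-% b (numeral f n) (f<b (suc n))

    numeral-lower : ∀ n → b ^ suc n ≤ numeral f n
    numeral-lower zero    = ≤-trans (≤-reflexive (*-comm b 1)) (m≤n+m (1 * b) (f 0))
    numeral-lower (suc n) = begin
      b * b ^ suc n                ≡⟨ *-comm b (b ^ suc n) ⟩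
      b ^ suc n * b                ≤⟨ *-monoˡ-≤ b (numeral-lower n) ⟩
      numeral f n * b              ≤⟨ m≤n+m _ (f (suc n)) ⟩
      f (suc n) + numeral f n * b  ∎
      where open ≤-Reasoning

    numeral-upper : ∀ n → numeral f n < b ^ (2 + n)
    numeral-upper zero    = append-< b (f<b 0) (subst (1 <_) (sym (*-identityʳ b)) (nonTrivial⇒n>1 b))
    numeral-upper (suc n) = append-< b (f<b (suc n)) (numeral-upper n)

    numeral-step : ∀ n → numeral f n < numeral f (suc n)
    numeral-step n = <-≤-trans (numeral-upper n) (numeral-lower (suc n))

    stage-numeral : ∀ n → stage (numeral f n) ≡ n
    stage-numeral n = inverse-unique (numeral-lower n) (numeral-upper n)
      where
      open StrictlyIncreasing (λ n → b ^ suc n) (λ n → ^-monoʳ-< b (nonTrivial⇒n>1 b) (n<1+n (suc n)))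

    truncate-numeral : ∀ k n → fold (numeral f (k + n)) (_/ b) k ≡ numeral f n
    truncate-numeral zero    n = refl
    truncate-numeral (suc k) n = begin
      fold (numeral f (suc k + n)) (_/ b) k / b
        ≡⟨ cong (λ m → fold (numeral f m) (_/ b) k / b) (+-suc k n) ⟨
      fold (numeral f (k + suc n)) (_/ b) k / b
        ≡⟨ cong (_/ b) (truncate-numeral k (suc n)) ⟩
      numeral f (suc n) / b
        ≡⟨ append-/ b (numeral f n) (f<b (suc n)) ⟩
      numeral f n  ∎
      where open ≡-Reasoning

    digit-numeral : ∀ {m n} → m ≤ n → digit m (numeral f n) ≡ f m
    digit-numeral {m} {n} m≤n = begin
      digit m (numeral f n)
        ≡⟨ cong (λ t → fold (numeral f n) (_/ b) (t ∸ m) % b) (stage-numeral n) ⟩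
      fold (numeral f n) (_/ b) (n ∸ m) % b
        ≡⟨ cong (λ t → fold (numeral f t) (_/ b) (n ∸ m) % b) (m∸n+n≡m m≤n) ⟨
      fold (numeral f (n ∸ m + m)) (_/ b) (n ∸ m) % b
        ≡⟨ cong (_% b) (truncate-numeral (n ∸ m) m) ⟩
      numeral f m % b
        ≡⟨ numeral-% m ⟩
      f m  ∎
      where open ≡-Reasoning

-- Orders copied along increasing sequences

Copied : (ℕ → ℕ) → (ℕ → ℕ) → Rel ℕ 0ℓ → Rel ℕ 0ℓ
Copied e r _≼_ x y = e (r x) ≡ x × e (r y) ≡ y × r x ≼ r y

module CopiedOrder {e r : ℕ → ℕ} {_≼_ : Rel ℕ 0ℓ} {d : Baire}
  (e-step : ∀ n → e n < e (suc n)) (r∘e : ∀ n → r (e n) ≡ n) (≼-isTotalOrder : IsTotalOrder _≡_ _≼_)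
  (d≤1 : ∀ p → d p ≤ 1) (d-codes : ∀ x y → d (pair x y) ≡ 1 ⇔ Copied e r _≼_ x y)
  where

  open LinOrd d
  open StrictlyIncreasing e e-step
  private module ≼ = IsTotalOrder ≼-isTotalOrder

  ≤L⇒Copied : ∀ x y → x ≤L y → Copied e r _≼_ x y
  ≤L⇒Copied x y = Equivalence.to (d-codes x y)

  Copied⇒≤L : ∀ x y → Copied e r _≼_ x y → x ≤L y
  Copied⇒≤L x y = Equivalence.from (d-codes x y)

  InL⇒e∘r : ∀ x → InL x → e (r x) ≡ x
  InL⇒e∘r x = proj₁ ∘ ≤L⇒Copied x x

  e∘r⇒InL : ∀ x → e (r x) ≡ x → InL x
  e∘r⇒InL x fixed = Copied⇒≤L x x (fixed , fixed , ≼.refl)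

  isLinearOrder : IsLinearOrder
  isLinearOrder = d≤1 , field-of , antisym , transitive , total
    where
    field-of : ∀ x y → x ≤L y → InL x × InL y
    field-of x y x≤y = let x∈e , y∈e , _ = ≤L⇒Copied x y x≤y in e∘r⇒InL x x∈e , e∘r⇒InL y y∈e

    antisym : ∀ x y → x ≤L y → y ≤L x → x ≡ y
    antisym x y x≤y y≤x =
      let x∈e , y∈e , rx≼ry = ≤L⇒Copied x y x≤y
          _   , _   , ry≼rx = ≤L⇒Copied y x y≤x
      in trans (sym x∈e) (trans (cong e (≼.antisym rx≼ry ry≼rx)) y∈e)

    transitive : ∀ x y z → x ≤L y → y ≤L z → x ≤L z
    transitive x y z x≤y y≤z =
      let x∈e , _   , rx≼ry = ≤L⇒Copied x y x≤y
          _   , z∈e , ry≼rz = ≤L⇒Copied y z y≤z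
      in Copied⇒≤L x z (x∈e , z∈e , ≼.trans rx≼ry ry≼rz)

    total : ∀ x y → InL x → InL y → x ≤L y ⊎ y ≤L x
    total x y x∈L y∈L =
      let x∈e = InL⇒e∘r x x∈L
          y∈e = InL⇒e∘r y y∈L
      in Sum.map (λ rx≼ry → Copied⇒≤L x y (x∈e , y∈e , rx≼ry))
                 (λ ry≼rx → Copied⇒≤L y x (y∈e , x∈e , ry≼rx)) (≼.total (r x) (r y))

  infiniteL : InfiniteL
  infiniteL n = e n , n≤vn n , e∘r⇒InL (e n) (cong e (r∘e n))

  e-injective : ∀ {a b} → e a ≡ e b → a ≡ b
  e-injective {a} {b} ea≡eb = trans (sym (r∘e a)) (trans (cong r ea≡eb) (r∘e b))

  e-mono : ∀ {a b} → a ≼ b → e a ≤L e b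
  e-mono {a} {b} a≼b = Copied⇒≤L (e a) (e b)
    (cong e (r∘e a) , cong e (r∘e b) , subst₂ _≼_ (sym (r∘e a)) (sym (r∘e b)) a≼b)

  module InfiniteSubset {s : Baire} (infinite : InfiniteSet s) (s⊆L : ∀ x → x ∈ₛ s → InL x) where

    Index : ℕ → Set
    Index n = e n ∈ₛ s

    ∈⇒Index : ∀ {x} → x ∈ₛ s → Index (r x)
    ∈⇒Index {x} x∈s = subst (_∈ₛ s) (sym (InL⇒e∘r x (s⊆L x x∈s))) x∈s

    index-unbounded : ∀ n → ∃ λ b → Index b × n ≤ b
    index-unbounded n with infinite (e n)
    ... | x , en≤x , x∈s = r x , ∈⇒Index x∈s , s≤s⁻¹ (cancel-< (begin-strict
      e n            ≤⟨ en≤x ⟩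
      x              ≡⟨ InL⇒e∘r x (s⊆L x x∈s) ⟨
      e (r x)        <⟨ e-step (r x) ⟩
      e (suc (r x))  ∎))
      where open ≤-Reasoning

    index-beyond : ∀ {_∼_ : Rel ℕ 0ℓ} → Total _∼_ →
                   ∀ {a m} → (∀ {b} → Index b → b ∼ a → b ≢ a → e b < m) →
                   ∀ n → ∃ λ b → Index b × n ≤ b × a < b × a ∼ b
    index-beyond {_∼_} total {a} {m} bound n with index-unbounded (n ⊔ m ⊔ suc a)
    ... | b , b∈s , max≤b = b , b∈s , ≤-trans (m≤m⊔n n m) n⊔m≤b , a<b , [ id , flip contradiction b≁a ]′ (total a b)
      where
      n⊔m≤b : n ⊔ m ≤ b
      n⊔m≤b = m⊔n≤o⇒m≤o (n ⊔ m) (suc a) max≤b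

      a<b : a < b
      a<b = m⊔n≤o⇒n≤o (n ⊔ m) (suc a) max≤b

      b≁a : ¬ b ∼ a
      b≁a b∼a = <⇒≱ (bound b∈s b∼a (>⇒≢ a<b)) (≤-trans (≤-trans (m≤n⊔m n m) n⊔m≤b) (n≤vn b))

    ascending⇒ : Ascending s → ∀ {a} → Index a → ∀ n → ∃ λ b → Index b × n ≤ b × a < b × a ≼ b
    ascending⇒ ascending {a} a∈s = let m , bound = ascending (e a) a∈s in
      index-beyond ≼.total λ {b} b∈s b≼a b≢a → bound (e b) b∈s (e-mono b≼a , b≢a ∘ e-injective)

    descending⇒ : Descending s → ∀ {a} → Index a → ∀ n → ∃ λ b → Index b × n ≤ b × a < b × b ≼ a
    descending⇒ descending {a} a∈s = let m , bound = descending (e a) a∈s in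
      index-beyond (λ x y → ≼.total y x) λ {b} b∈s a≼b b≢a →
        bound (e b) b∈s (e-mono a≼b , b≢a ∘ sym ∘ e-injective)

-- Phases

advance : ℕ → ℕ → ℕ
advance p c = 𝟙 (c ≟ p % 3) + p

phase : Baire → ℕ → ℕ
phase = scan advance 0

phaseᶜ : Computable F → Computable (λ f xs → phase f (F f xs))
phaseᶜ = scanᶜ (indicator (var 1F ≡ᵈ var 0F %ᶜ 3) +ᶜ var 0F) 0

phase-mono : ∀ f {m n} → m ≤ n → phase f m ≤ phase f n
phase-mono f = step⇒mono-≤ λ n → m≤n+m (phase f n) _

advance-avoids : ∀ p c → c ≢ advance p c % 3
advance-avoids p c with c ≟ p % 3
... | yes c≡p = λ c≡1+p → m%b≢[1+m]%b 3 p (trans (sym c≡p) c≡1+p)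
... | no  c≢p = c≢p

advance-reads : ∀ p c {u} → p ≤ u → u < advance p c → c ≡ u % 3
advance-reads p c p≤u u<a with c ≟ p % 3 | u<a
... | yes c≡p | u<1+p = trans c≡p (cong (_% 3) (≤-antisym p≤u (s≤s⁻¹ u<1+p)))
... | no _    | u<p   = contradiction p≤u (<⇒≱ u<p)

phase-avoids : ∀ f n → f n ≢ phase f n % 3
phase-avoids f zero    = advance-avoids 0 (f 0)
phase-avoids f (suc n) = advance-avoids (phase f n) (f (suc n))

phase-passes : ∀ f {a b u} → phase f a ≤ u → u < phase f b → ∃ λ m → a ≤ m × f m ≡ u % 3
phase-passes f {a} {zero} a≤u u<0 = contradiction (≤-trans (phase-mono f {n = a} z≤n) a≤u) (<⇒≱ u<0)
phase-passes f {a} {suc b} {u} a≤u u<1+b with u <? phase f b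
... | yes u<b = phase-passes f {a} {b} a≤u u<b
... | no  u≮b = suc b , <⇒≤ (mono-≤⇒cancel-< (phase-mono f) {a} (≤-<-trans a≤u u<1+b)) ,
  advance-reads (phase f b) (f (suc b)) (≮⇒≥ u≮b) u<1+b

colour-between : ∀ f {a b} → 3 + phase f a ≤ phase f b → ∀ {c} → c < 3 → ∃ λ m → a ≤ m × f m ≡ c
colour-between f {a} {b} 3+a≤b c<3 with residue-reached 3 (phase f a) c<3
... | j , j<3 , residue with phase-passes f {a} {b} (m≤n+m _ j) (<-≤-trans (+-monoˡ-< _ j<3) 3+a≤b)
...   | m , a≤m , colour = m , a≤m , trans colour residue

-- The linear order of a colouring

Lower : Baire → ℕ → Set
Lower f n = f n ≡ suc (phase f n) % 3

lower? : ∀ f n → Dec (Lower f n)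
lower? f n = f n ≟ suc (phase f n) % 3

_⊑_ : Rel (ℕ × ℕ) 0ℓ
_⊑_ = ×-Lex _≡_ _≤_ _≥_

Inside : Baire → ℕ → ℕ → Set
Inside f a b = (phase f a , a) ⊑ (phase f b , b)

onSide : Dec A → B → B ⊎ B
onSide (yes _) = inj₁
onSide (no _)  = inj₂

onSide-⊎-< : ∀ {R S : Rel B 0ℓ} {x y} (A? : Dec A) (C? : Dec C) →
             ((A × (¬ C ⊎ R x y)) ⊎ (¬ A × ¬ C × S x y)) ⇔ (R ⊎-< S) (onSide A? x) (onSide C? y)
onSide-⊎-< (yes a) (no ¬c) = mk⇔ (λ _ → ₁∼₂) (λ _ → inj₁ (a , inj₁ ¬c))
onSide-⊎-< (yes a) (yes c) = mk⇔
  (λ { (inj₁ (_ , inj₁ ¬c))  → contradiction c ¬c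
     ; (inj₁ (_ , inj₂ Rxy)) → ₁∼₁ Rxy
     ; (inj₂ (¬a , _))       → contradiction a ¬a })
  (λ { (₁∼₁ Rxy) → inj₁ (a , inj₂ Rxy) })
onSide-⊎-< (no ¬a) (no ¬c) = mk⇔
  (λ { (inj₁ (a , _))       → contradiction a ¬a
     ; (inj₂ (_ , _ , Sxy)) → ₂∼₂ Sxy })
  (λ { (₂∼₂ Sxy) → inj₂ (¬a , ¬c , Sxy) })
onSide-⊎-< (no ¬a) (yes c) = mk⇔
  (λ { (inj₁ (a , _))      → contradiction a ¬a
     ; (inj₂ (_ , ¬c , _)) → contradiction c ¬c })
  (λ ())

place : Baire → ℕ → (ℕ × ℕ) ⊎ (ℕ × ℕ)
place f n = onSide (lower? f n) (phase f n , n)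

_⊢_≼_ : Baire → ℕ → ℕ → Set
f ⊢ a ≼ b = (flip _⊑_ ⊎-< _⊑_) (place f a) (place f b)

_≋_ : Rel (ℕ × ℕ) 0ℓ
_≋_ = ×-Pointwise _≡_ _≡_

⊑-isTotalOrder : IsTotalOrder _≋_ _⊑_
⊑-isTotalOrder = ×-isTotalOrder _≟_ ≤-isTotalOrder (Flip.isTotalOrder ≤-isTotalOrder)

place-injective : ∀ f {a b} → ⊎-Pointwise _≋_ _≋_ (place f a) (place f b) → a ≡ b
place-injective f {a} {b} pa≈pb with lower? f a | lower? f b | pa≈pb
... | yes _ | yes _ | inj₁ (_ , a≡b) = a≡b
... | no _  | no _  | inj₂ (_ , a≡b) = a≡b

≼-isTotalOrder : ∀ f → IsTotalOrder _≡_ (f ⊢_≼_)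
≼-isTotalOrder f = record
  { isPartialOrder = record
    { isPreorder = record
      { isEquivalence = isEquivalence
      ; reflexive     = λ { {a} refl → ≼.refl {a} }
      ; trans         = λ {a b c} → ≼.trans {a} {b} {c}
      }
    ; antisym = λ {a b} a≼b b≼a → place-injective f (≼.antisym {a} {b} a≼b b≼a)
    }
  ; total = ≼.total
  }
  where
  module ≼ = IsTotalOrder (On.isTotalOrder (place f)
    (⊎-<-isTotalOrder (Flip.isTotalOrder ⊑-isTotalOrder) ⊑-isTotalOrder))

lowerᵈ : Computable F → Decidable (λ f xs → Lower f (F f xs))
lowerᵈ g = oracleᶜ g ≡ᵈ 1+ᶜ phaseᶜ g %ᶜ 3

insideᵈ : Computable F → Computable G → Decidable (λ f xs → Inside f (F f xs) (G f xs))
insideᵈ g h = phaseᶜ g ≤ᵈ phaseᶜ h ×ᵈ ¬ᵈ phaseᶜ g ≡ᵈ phaseᶜ h ⊎ᵈ phaseᶜ g ≡ᵈ phaseᶜ h ×ᵈ h ≤ᵈ g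

≼ᵈ : Computable F → Computable G → Decidable (λ f xs → f ⊢ F f xs ≼ G f xs)
≼ᵈ {F = F} {G = G} g h = Decidable-resp (λ f xs → onSide-⊎-< (lower? f (F f xs)) (lower? f (G f xs)))
  (lowerᵈ g ×ᵈ (¬ᵈ lowerᵈ h ⊎ᵈ insideᵈ h g) ⊎ᵈ ¬ᵈ lowerᵈ g ×ᵈ ¬ᵈ lowerᵈ h ×ᵈ insideᵈ g h)

-- The colours of an infinite chain

-- Good is the side of each phase on which the chain may stay for ever: the lower one for
-- ascending chains, the upper one for descending chains.
data Follows (f : Baire) (Good Bad : ℕ → Set) (a b : ℕ) : Set where
  settles : Good a → Good b → phase f a ≡ phase f b → Follows f Good Bad a b
  drifts  : Bad b → Good a ⊎ phase f a < phase f b → Follows f Good Bad a b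

module _ {f : Baire} {a b : ℕ} (a<b : a < b) where

  inside⇒phase-< : Inside f a b → phase f a < phase f b
  inside⇒phase-< (inj₁ (p≤q , p≢q)) = ≤∧≢⇒< p≤q p≢q
  inside⇒phase-< (inj₂ (_ , b≤a))   = contradiction b≤a (<⇒≱ a<b)

  outside⇒phase-≡ : Inside f b a → phase f a ≡ phase f b
  outside⇒phase-≡ (inj₁ (q≤p , _)) = ≤-antisym (phase-mono f (<⇒≤ a<b)) q≤p
  outside⇒phase-≡ (inj₂ (q≡p , _)) = sym q≡p

  ≼⇒Follows : f ⊢ a ≼ b → Follows f (Lower f) (¬_ ∘ Lower f) a b
  ≼⇒Follows a≼b with lower? f a | lower? f b | a≼b
  ... | yes la | no ¬lb | ₁∼₂   = drifts ¬lb (inj₁ la)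
  ... | yes la | yes lb | ₁∼₁ i = settles la lb (outside⇒phase-≡ i)
  ... | no _   | no ¬lb | ₂∼₂ i = drifts ¬lb (inj₂ (inside⇒phase-< i))

  ≽⇒Follows : f ⊢ b ≼ a → Follows f (¬_ ∘ Lower f) (Lower f) a b
  ≽⇒Follows b≼a with lower? f b | lower? f a | b≼a
  ... | yes lb | no ¬la | ₁∼₂   = drifts lb (inj₁ ¬la)
  ... | yes lb | yes _  | ₁∼₁ i = drifts lb (inj₂ (inside⇒phase-< i))
  ... | no ¬lb | no ¬la | ₂∼₂ i = settles ¬la ¬lb (outside⇒phase-≡ i)

module ChainColours {f : Baire} (f<3 : Colouring 3 f) {Good Bad Chain : ℕ → Set}
  (good⇒¬bad : ∀ {n} → Good n → ¬ Bad n)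
  (monochromatic : ∀ {a b} → Good a → Good b → phase f a ≡ phase f b → f a ≡ f b)
  (extend : ∀ {a} → Chain a → ∀ n → ∃ λ b → Chain b × n ≤ b × Follows f Good Bad a b)
  where

  -- From a bad point the chain can only go on by drifting to later phases.
  bad-drifts : ∀ k {a} → Chain a → Bad a → ∃ λ b → k + phase f a ≤ phase f b
  bad-drifts zero    {a} _ _ = a , ≤-refl
  bad-drifts (suc k) {a} a∈c bad-a with extend a∈c 0
  ... | b , _   , _ , settles good-a _ _     = contradiction bad-a (good⇒¬bad good-a)
  ... | b , _   , _ , drifts _ (inj₁ good-a) = contradiction bad-a (good⇒¬bad good-a)
  ... | b , b∈c , _ , drifts bad-b (inj₂ a<b) with bad-drifts k b∈c bad-b
  ...   | d , k+b≤d = d , (begin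
    suc k + phase f a    ≡⟨ +-suc k (phase f a) ⟨
    k + suc (phase f a)  ≤⟨ +-monoʳ-≤ k a<b ⟩
    k + phase f b        ≤⟨ k+b≤d ⟩
    phase f d            ∎)
    where open ≤-Reasoning

  colour-recurs : ∀ {a} → Chain a → ∀ n → ∃ λ m → n ≤ m × f m ≡ f a
  colour-recurs {a} a∈c n with extend a∈c n
  ... | b , _   , n≤b , settles good-a good-b same = b , n≤b , monochromatic good-b good-a (sym same)
  ... | b , b∈c , n≤b , drifts bad-b _ with bad-drifts 3 b∈c bad-b
  ...   | d , 3+b≤d with colour-between f {b} {d} 3+b≤d (f<3 a)
  ...     | m , b≤m , fm≡fa = m , ≤-trans n≤b b≤m , fm≡fa

lower-monochromatic : ∀ f {a b} → Lower f a → Lower f b → phase f a ≡ phase f b → f a ≡ f b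
lower-monochromatic f la lb same = trans la (trans (cong (λ p → suc p % 3) same) (sym lb))

upper-colour : ∀ f {n} → f n < 3 → ¬ Lower f n → f n ≡ (2 + phase f n) % 3
upper-colour f {n} fn<3 ¬ln with residue-reached 3 (phase f n) fn<3
... | 0 , _ , p≡fn   = contradiction (sym p≡fn) (phase-avoids f n)
... | 1 , _ , 1+p≡fn = contradiction (sym 1+p≡fn) ¬ln
... | 2 , _ , 2+p≡fn = sym 2+p≡fn
... | suc (suc (suc _)) , s≤s (s≤s (s≤s ())) , _

upper-monochromatic : ∀ {f} → Colouring 3 f →
                      ∀ {a b} → ¬ Lower f a → ¬ Lower f b → phase f a ≡ phase f b → f a ≡ f b
upper-monochromatic {f} f<3 {a} {b} ¬la ¬lb same = begin
  f a                  ≡⟨ upper-colour f (f<3 a) ¬la ⟩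
  (2 + phase f a) % 3  ≡⟨ cong (λ p → (2 + p) % 3) same ⟩
  (2 + phase f b) % 3  ≡⟨ upper-colour f (f<3 b) ¬lb ⟨
  f b                  ∎
  where open ≡-Reasoning

-- The reduction

open Numeral 3

copiedᵈ : Computable F → Computable G →
          Decidable λ f xs → Copied (numeral f) stage (f ⊢_≼_) (F f xs) (G f xs)
copiedᵈ g h = numeralᶜ (stageᶜ g) ≡ᵈ g ×ᵈ numeralᶜ (stageᶜ h) ≡ᵈ h ×ᵈ ≼ᵈ (stageᶜ g) (stageᶜ h)

orderᵈ : Decidable {1} λ f xs →
         Copied (numeral f) stage (f ⊢_≼_) (unpair₁ (lookup xs 0F)) (unpair₂ (lookup xs 0F))
orderᵈ = copiedᵈ (unpair₁ᶜ (var 0F)) (unpair₂ᶜ (var 0F))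

order : Baire → Baire
order f p = 𝟙 (decide orderᵈ f (p ∷ []))

order-codes : ∀ f x y → order f (pair x y) ≡ 1 ⇔ Copied (numeral f) stage (f ⊢_≼_) x y
order-codes f x y = mk⇔
  (subst₂ R (unpair₁-pair x y) (unpair₂-pair x y) ∘ 𝟙≡1⇒ R?)
  (⇒𝟙≡1 R? ∘ subst₂ R (sym (unpair₁-pair x y)) (sym (unpair₂-pair x y)))
  where
  R : Rel ℕ 0ℓ
  R = Copied (numeral f) stage (f ⊢_≼_)

  R? : Dec (R (unpair₁ (pair x y)) (unpair₂ (pair x y)))
  R? = decide orderᵈ f (pair x y ∷ [])

memberᵈ : Computable F → Decidable (λ s xs → F s xs ∈ₛ s)
memberᵈ g = oracleᶜ g ≡ᵈ constᶜ 1

longMemberᵈ : Decidable {2} λ s xs → lookup xs 0F ∈ₛ s × lookup xs 1F ≤ stage (lookup xs 0F)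
longMemberᵈ = memberᵈ (var 0F) ×ᵈ var 1F ≤ᵈ stageᶜ (var 0F)

sameColourᵈ : Decidable {3} λ _ xs → digit (lookup xs 0F) (lookup xs 1F) ≡ lookup xs 2F % 3
sameColourᵈ = digitᶜ (var 0F) (var 1F) ≡ᵈ var 2F %ᶜ 3

colourClass : Baire → ℕ → Baire
colourClass f c m = 𝟙 (f m ≟ c)

-- The search for the reference member takes no arguments, so that it finds the same member
-- for every input.
colourClassCode : Code 1
colourClassCode = cmp (code (indicator sameColourᵈ))
  (prj 0F ∷ search longMemberᵈ ∷ cmp (search (memberᵈ (var 0F))) [] ∷ [])

colourClassCode-correct : ∀ {f} → Colouring 3 f → ∀ {s} →
                          (∀ n → ∃ λ b → numeral f b ∈ₛ s × n ≤ b) →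
                          (∀ x → x ∈ₛ s → numeral f (stage x) ≡ x) →
                          ∃ λ a → numeral f a ∈ₛ s × (colourClassCode ⟦ s ⟧≡ colourClass f (f a))
colourClassCode-correct {f} f<3 {s} unbounded s⊆numerals
  with search-finds (memberᵈ (var 0F)) s [] (let b , b∈s , _ = unbounded 0 in numeral f b , b∈s)
... | x₀ , x₀∈s , finds-x₀ = stage x₀ , subst (_∈ₛ s) (sym x₀-numeral) x₀∈s , computes
  where
  x₀-numeral : numeral f (stage x₀) ≡ x₀
  x₀-numeral = s⊆numerals x₀ x₀∈s

  longMember : ∀ m → ∃ λ x → x ∈ₛ s × m ≤ stage x
  longMember m = let b , b∈s , m≤b = unbounded m in
    numeral f b , b∈s , subst (m ≤_) (sym (stage-numeral f<3 b)) m≤b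

  x₀-colour : x₀ % 3 ≡ f (stage x₀)
  x₀-colour = trans (cong (_% 3) (sym x₀-numeral)) (numeral-% f<3 (stage x₀))

  computes : colourClassCode ⟦ s ⟧≡ colourClass f (f (stage x₀))
  computes m with search-finds longMemberᵈ s (m ∷ []) (longMember m)
  ... | x , (x∈s , m≤x) , finds-x = subst (Eval s colourClassCode (m ∷ []))
    (cong₂ (λ c c₀ → 𝟙 (c ≟ c₀)) x-digit x₀-colour)
    (ev-cmp (evs-∷ ev-prj (evs-∷ finds-x (evs-∷ (ev-cmp evs-[] finds-x₀) evs-[])))
            (correct (indicator sameColourᵈ) s (m ∷ x ∷ x₀ ∷ [])))
    where
    x-digit : digit m x ≡ f m
    x-digit = trans (cong (digit m) (sym (s⊆numerals x x∈s))) (digit-numeral f<3 m≤x)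

colourClass-sol : ∀ f c → (∀ n → ∃ λ m → n ≤ m × f m ≡ c) → Problem.sol RT13 f (colourClass f c)
colourClass-sol f c recurs =
  (λ m → 𝟙≤1 (f m ≟ c)) ,
  (λ n → let m , n≤m , fm≡c = recurs n in m , n≤m , ⇒𝟙≡1 (f m ≟ c) fm≡c) ,
  c , λ m → 𝟙≡1⇒ (f m ≟ c)

module Reduction (f : Baire) (f<3 : Colouring 3 f) where

  open CopiedOrder {r = stage} (numeral-step f<3) (stage-numeral f<3) (≼-isTotalOrder f)
    (λ p → 𝟙≤1 (decide orderᵈ f (p ∷ []))) (order-codes f) public

  order-dom : Problem.dom ADC (order f)
  order-dom = isLinearOrder , infiniteL

  chain-colour-recurs : ∀ {s} → Problem.sol ADC (order f) s →
                        ∀ {a} → numeral f a ∈ₛ s → ∀ n → ∃ λ m → n ≤ m × f m ≡ f a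
  chain-colour-recurs (_ , infinite , s⊆L , inj₁ ascending) =
    ChainColours.colour-recurs f<3 contradiction (lower-monochromatic f)
      (λ a∈s n → let b , b∈s , n≤b , a<b , a≼b = ascending⇒ ascending a∈s n
                 in  b , b∈s , n≤b , ≼⇒Follows a<b a≼b)
    where open InfiniteSubset infinite s⊆L
  chain-colour-recurs (_ , infinite , s⊆L , inj₂ descending) =
    ChainColours.colour-recurs f<3 (flip contradiction) (upper-monochromatic f<3)
      (λ a∈s n → let b , b∈s , n≤b , a<b , b≼a = descending⇒ descending a∈s n
                 in  b , b∈s , n≤b , ≽⇒Follows a<b b≼a)
    where open InfiniteSubset infinite s⊆L

theorem4p22 : RT13 ≤sW ADC
theorem4p22 = code (indicator orderᵈ) , colourClassCode , λ f f<3 →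
  let open Reduction f f<3 in
  order f , (λ n → correct (indicator orderᵈ) f (n ∷ [])) , order-dom ,
  λ s sol@(_ , infinite , s⊆L , _) →
    let open InfiniteSubset infinite s⊆L
        a , a∈s , computes = colourClassCode-correct f<3 index-unbounded (λ x → InL⇒e∘r x ∘ s⊆L x)
    in colourClass f (f a) , computes , colourClass-sol f (f a) (chain-colour-recurs sol a∈s)
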